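{- For every $\varepsilon>0$ there exists $N$ such that for every $n\ge N$ the following holds: if $V$ is a set of $n$ vertices and $\mathcal{T}$ is a family (multiset, so repeated members are allowed and counted with multiplicity) of triangles on $V$ having no rainbow triangle, then $|\mathcal{T}|\le (1+\varepsilon)\frac{n^2}{8}$. Equivalently, $|\mathcal{T}|\le \frac{n^2}{8}(1+o(1))$ as $n\to\infty$.
   Context: A triangle on $V$ is a $3$-element subset $\{x,y,z\}\subseteq V$, identified with its edge set $\{\{x,y\},\{y,z\},\{x,z\}\}$. In a family (multiset) $\mathcal{T}$ of triangles, repeated copies of the same triangle are treated as different members. A rainbow triangle is a triangle $\{x,y,z\}$ on $V$ together with three distinct members $t_1,t_2,t_3$ of $\mathcal{T}$ (distinct as members of the multiset, though possibly equal as sets) such that $\{x,y\}$ is an edge of $t_1$, $\{y,z\}$ is an edge of $t_2$ and $\{x,z\}$ is an edge of $t_3$. -}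

module Defs where

open import Data.Nat using (ℕ)
open import Data.Fin using (Fin)
open import Data.Fin.Subset using (Subset; _∈_; ∣_∣)
open import Data.List using (List; length; lookup)
open import Data.Product using (_×_)
open import Relation.Binary.PropositionalEquality using (_≡_; _≢_)

record Triangle (n : ℕ) : Set where
  field
    vertices : Subset n
    card     : ∣ vertices ∣ ≡ 3

open Triangle public

-- The edges of a triangle are exactly the 2-element subsets of its vertex set.
IsEdgeOf : ∀ {n} → Fin n → Fin n → Triangle n → Set
IsEdgeOf x y t = x ≢ y × x ∈ vertices t × y ∈ vertices t

-- A multiset of triangles is a list whose order is irrelevant. Its members are
-- the positions in the list, so equal triangles at different positions are
-- different members, and its cardinality with multiplicity is the length.
Family : ℕ → Set
Family n = List (Triangle n)

Member : ∀ {n} → Family n → Set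
Member T = Fin (length T)

record RainbowTriangle {n : ℕ} (T : Family n) : Set where
  field
    x y z    : Fin n
    x≢y      : x ≢ y
    y≢z      : y ≢ z
    x≢z      : x ≢ z
    t₁ t₂ t₃ : Member T
    t₁≢t₂    : t₁ ≢ t₂
    t₂≢t₃    : t₂ ≢ t₃
    t₁≢t₃    : t₁ ≢ t₃
    xy∈t₁    : IsEdgeOf x y (lookup T t₁)
    yz∈t₂    : IsEdgeOf y z (lookup T t₂)
    xz∈t₃    : IsEdgeOf x z (lookup T t₃)

-- Call a pair covered if it is an edge of a member. A triangle of covered pairs
-- spans a member, since otherwise it would be rainbow. Comparing a member with
-- those that share its edges, either two of its edges lie in no other member,
-- or all three of its edges lie in exactly one other member, equal to it as a
-- set. Let d̄(v) = n − d(v), where d is the degree in the graph of covered pairs.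
-- If p q is an edge of the first kind then d̄(p) + d̄(q) ≥ n − 1, and a repeated
-- triangle p q r has d̄(p) + d̄(q) + d̄(r) ≥ 2n − 3, because outside it no vertex
-- is joined to two of p, q, r. Distribute 2 (d̄(x) + d̄(y)) over the members on
-- each covered edge xy of multiplicity 1 or 2: every member receives at least
-- 4n − 6, while the total is at most 2 Σ d(v) d̄(v) ≤ n³ / 2. Hence
-- |T| (8n − 12) ≤ n³.

module Submission where

open import Data.Bool using (if_then_else_)
open import Data.Fin using (Fin; zero; suc; punchOut; _≟_)
open import Data.Fin.Patterns using (0F; 1F; 2F)
open import Data.Fin.Properties using (any?; suc-injective; punchIn-punchOut; punchOut-injective)
open import Data.Fin.Subset using (Subset; inside; outside; _∈_; _⊆_; ∣_∣)
open import Data.Fin.Subset.Properties using (_∈?_; p⊂q⇒∣p∣<∣q∣)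
open import Data.Nat as ℕ using (ℕ; zero; suc; z≤n; s≤s; _≥_; _^_)
open import Data.Nat.Properties using (+-*-semiring)
open import Data.Nat.Tactic.RingSolver using (solve-∀)
open import Data.List using (length; lookup)
open import Data.Product using (∃-syntax; _×_; _,_; proj₁; proj₂)
open import Data.Sum using (_⊎_; inj₁; inj₂)
open import Data.Vec using ([]; _∷_; here; there)
open import Data.Vec.Functional using (Vector; removeAt)
open import Function using (_∘_)
open import Function.Definitions using (Injective)
open import Relation.Binary.PropositionalEquality
  using (_≡_; _≢_; refl; sym; trans; cong; cong₂; subst; ≢-sym)
open import Relation.Nullary using (¬_; Dec; does; yes; no; contradiction; ¬?; _×-dec_)
open import Relation.Nullary.Decidable using (decidable-stable; dec-true)
open import Algebra.Properties.Semiring.Sum +-*-semiring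
  using (sum; sum-cong-≗; sum-replicate-zero; sum-remove; ∑-distrib-+; ∑-comm; *-distribˡ-sum; *-distribʳ-sum)
open import Defs

module Combinatorics where

  open import Data.Nat using (_+_; _*_; _≤_)
  open import Data.Nat.Properties hiding (_≟_; suc-injective)

  private variable
    n : ℕ
    A B C X Y Z : Set

  -- Finite sums and indicators.

  sum-mono-≤ : {f g : Vector ℕ n} → (∀ i → f i ≤ g i) → sum f ≤ sum g
  sum-mono-≤ {n = zero}  f≤g = z≤n
  sum-mono-≤ {n = suc _} f≤g = +-mono-≤ (f≤g zero) (sum-mono-≤ (f≤g ∘ suc))

  sum-const : ∀ n c → sum {n} (λ _ → c) ≡ n * c
  sum-const zero    c = refl
  sum-const (suc n) c = cong (c +_) (sum-const n c)

  term≤sum : (f : Vector ℕ n) (p : Fin n) → f p ≤ sum f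
  term≤sum {n = suc _} f p = subst (f p ≤_) (sym (sum-remove {i = p} f)) (m≤m+n _ _)

  two-terms≤sum : (f : Vector ℕ n) {p q : Fin n} → p ≢ q → f p + f q ≤ sum f
  two-terms≤sum {n = suc _} f {p} {q} p≢q = begin
    f p + f q                         ≡⟨ cong (λ i → f p + f i) (punchIn-punchOut p≢q) ⟨
    f p + removeAt f p (punchOut p≢q) ≤⟨ +-monoʳ-≤ (f p) (term≤sum (removeAt f p) _) ⟩
    f p + sum (removeAt f p)          ≡⟨ sum-remove {i = p} f ⟨
    sum f                             ∎
    where open ≤-Reasoning

  three-terms≤sum : (f : Vector ℕ n) {p q r : Fin n} → p ≢ q → q ≢ r → p ≢ r →
                    f p + (f q + f r) ≤ sum f
  three-terms≤sum {n = suc _} f {p} {q} {r} p≢q q≢r p≢r = begin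
    f p + (f q + f r)
      ≡⟨ cong₂ (λ i j → f p + (f i + f j)) (punchIn-punchOut p≢q) (punchIn-punchOut p≢r) ⟨
    f p + (removeAt f p (punchOut p≢q) + removeAt f p (punchOut p≢r))
      ≤⟨ +-monoʳ-≤ (f p) (two-terms≤sum (removeAt f p) (q≢r ∘ punchOut-injective p≢q p≢r)) ⟩
    f p + sum (removeAt f p)
      ≡⟨ sum-remove {i = p} f ⟨
    sum f ∎
    where open ≤-Reasoning

  indicator : Dec A → ℕ
  indicator d = if does d then 1 else 0

  indicator-true : (d : Dec A) → A → indicator d ≡ 1
  indicator-true d a = cong (λ b → if b then 1 else 0) (dec-true d a)

  indicator-mono : (a : Dec A) (b : Dec B) → (A → B) → indicator a ≤ indicator b
  indicator-mono (no _)  b A⇒B = z≤n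
  indicator-mono (yes x) b A⇒B = ≤-reflexive (sym (indicator-true b (A⇒B x)))

  indicator-⊎ : (a : Dec A) (b : Dec B) (c : Dec C) → (A → B ⊎ C) →
                indicator a ≤ indicator b + indicator c
  indicator-⊎ (no _)  b c A⇒B⊎C = z≤n
  indicator-⊎ (yes x) b c A⇒B⊎C with A⇒B⊎C x
  ... | inj₁ y = ≤-trans (indicator-mono (yes x) b (λ _ → y)) (m≤m+n _ _)
  ... | inj₂ z = ≤-trans (indicator-mono (yes x) c (λ _ → z)) (m≤n+m _ _)

  indicator-complement : (a : Dec A) → indicator a + indicator (¬? a) ≡ 1
  indicator-complement (yes _) = refl
  indicator-complement (no _)  = refl

  sum-point : (j : Fin n) → sum (λ i → indicator (i ≟ j)) ≡ 1
  sum-point {n = suc n} zero    = cong suc (sum-replicate-zero n)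
  sum-point {n = suc _} (suc j) = sum-point j

  -- Used at a vertex z, where `a` and `b` say that z is joined to the ends of an edge and `c` that
  -- z is the third corner.
  one≤ : (a : Dec A) (b : Dec B) (c : Dec C) → (A → B → C) →
         1 ≤ indicator (¬? a) + indicator (¬? b) + indicator c
  one≤ (no _)  b       c f = s≤s z≤n
  one≤ (yes _) (no _)  c f = s≤s z≤n
  one≤ (yes x) (yes y) c f = ≤-reflexive (sym (indicator-true c (f x y)))

  -- Used at a vertex z, where a, b, c say that z is joined to the three corners
  -- and p, q, r that z is that corner.
  two≤ : (a : Dec A) (b : Dec B) (c : Dec C) (p : Dec X) (q : Dec Y) (r : Dec Z) →
         (X → ¬ A) → (Y → ¬ B) → (Z → ¬ C) → (B → C → X) → (A → C → Y) → (A → B → Z) →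
         2 ≤ indicator (¬? a) + indicator (¬? b) + indicator (¬? c) +
             (indicator p + indicator q + indicator r)
  two≤ (no _)  (no _)  c       p q r X¬A Y¬B Z¬C f g h = s≤s (s≤s z≤n)
  two≤ (no _)  (yes _) (no _)  p q r X¬A Y¬B Z¬C f g h = s≤s (s≤s z≤n)
  two≤ (yes _) (no _)  (no _)  p q r X¬A Y¬B Z¬C f g h = s≤s (s≤s z≤n)
  two≤ (no _)  (yes y) (yes z) p q r X¬A Y¬B Z¬C f g h with p
  ... | yes _ = s≤s (s≤s z≤n)
  ... | no ¬p = contradiction (f y z) ¬p
  two≤ (yes x) (no _)  (yes z) p q r X¬A Y¬B Z¬C f g h with q
  ... | no ¬q = contradiction (g x z) ¬q
  ... | yes _ with p
  ...   | yes _ = s≤s (s≤s z≤n)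
  ...   | no  _ = s≤s (s≤s z≤n)
  two≤ (yes x) (yes y) (no _)  p q r X¬A Y¬B Z¬C f g h =
    s≤s (≤-trans (≤-reflexive (sym (indicator-true r (h x y)))) (m≤n+m _ _))
  two≤ (yes x) (yes y) (yes z) p q r X¬A Y¬B Z¬C f g h = contradiction z (Z¬C (h x y))

  -- Corners of a triangle.

  enumerate : (s : Subset n) → ∃[ v ] ((∀ (i : Fin ∣ s ∣) → v i ∈ s) ×
              Injective _≡_ _≡_ v × (∀ {z} → z ∈ s → ∃[ i ] z ≡ v i))
  enumerate []            = (λ ()) , (λ ()) , (λ { {()} }) , λ ()
  enumerate (outside ∷ s) with enumerate s
  ... | v , v∈ , inj , surj =
    suc ∘ v , there ∘ v∈ , inj ∘ suc-injective ,
    λ { (there z∈s) → let i , eq = surj z∈s in i , cong suc eq }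
  enumerate {n = suc n} (inside ∷ s) with enumerate s
  ... | v , v∈ , inj , surj = w , w∈ , w-inj , w-surj
    where
    w : Fin (suc ∣ s ∣) → Fin (suc n)
    w zero    = zero
    w (suc i) = suc (v i)
    w∈ : ∀ i → w i ∈ inside ∷ s
    w∈ zero    = here
    w∈ (suc i) = there (v∈ i)
    w-inj : Injective _≡_ _≡_ w
    w-inj {zero}  {zero}  _  = refl
    w-inj {suc _} {suc _} eq = cong suc (inj (suc-injective eq))
    w-surj : ∀ {z} → z ∈ inside ∷ s → ∃[ i ] z ≡ w i
    w-surj here        = zero , refl
    w-surj (there z∈s) = let i , eq = surj z∈s in suc i , cong suc eq

  -- The order of the corners matters: later arguments single out the edge `p q` or the middle
  -- corner `q`, and `swap₁₂` and `swap₂₃` generate all other orders.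
  record Corners (t : Triangle n) (p q r : Fin n) : Set where
    field
      p≢q   : p ≢ q
      q≢r   : q ≢ r
      p≢r   : p ≢ r
      p∈    : p ∈ vertices t
      q∈    : q ∈ vertices t
      r∈    : r ∈ vertices t
      cover : ∀ {z} → z ∈ vertices t → z ≡ p ⊎ z ≡ q ⊎ z ≡ r

  open Corners

  corners : (t : Triangle n) → ∃[ p ] ∃[ q ] ∃[ r ] Corners t p q r
  -- Abstracting the cardinality lets `card t` turn the index type of the enumeration into `Fin 3`.
  corners t with ∣ vertices t ∣ | card t | enumerate (vertices t)
  ... | _ | refl | v , v∈ , inj , surj = v 0F , v 1F , v 2F , record
    { p≢q = λ eq → contradiction (inj eq) λ ()
    ; q≢r = λ eq → contradiction (inj eq) λ ()
    ; p≢r = λ eq → contradiction (inj eq) λ ()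
    ; p∈ = v∈ 0F ; q∈ = v∈ 1F ; r∈ = v∈ 2F
    ; cover = λ z∈ → locate (surj z∈)
    }
    where
    locate : ∀ {z} → ∃[ i ] z ≡ v i → z ≡ v 0F ⊎ z ≡ v 1F ⊎ z ≡ v 2F
    locate (0F , eq) = inj₁ eq
    locate (1F , eq) = inj₂ (inj₁ eq)
    locate (2F , eq) = inj₂ (inj₂ eq)

  swap₁₂ : ∀ {t : Triangle n} {p q r} → Corners t p q r → Corners t q p r
  swap₁₂ c = record
    { p≢q = ≢-sym (p≢q c) ; q≢r = p≢r c ; p≢r = q≢r c ; p∈ = q∈ c ; q∈ = p∈ c ; r∈ = r∈ c
    ; cover = λ z∈ → swap (cover c z∈) }
    where
    swap : A ⊎ B ⊎ C → B ⊎ A ⊎ C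
    swap (inj₁ x)        = inj₂ (inj₁ x)
    swap (inj₂ (inj₁ y)) = inj₁ y
    swap (inj₂ (inj₂ z)) = inj₂ (inj₂ z)

  swap₂₃ : ∀ {t : Triangle n} {p q r} → Corners t p q r → Corners t p r q
  swap₂₃ c = record
    { p≢q = p≢r c ; q≢r = ≢-sym (q≢r c) ; p≢r = p≢q c ; p∈ = p∈ c ; q∈ = r∈ c ; r∈ = q∈ c
    ; cover = λ z∈ → swap (cover c z∈) }
    where
    swap : A ⊎ B ⊎ C → A ⊎ C ⊎ B
    swap (inj₁ x)        = inj₁ x
    swap (inj₂ (inj₁ y)) = inj₂ (inj₂ y)
    swap (inj₂ (inj₂ z)) = inj₂ (inj₁ z)

  -- A vertex of `s` outside `t` would make the inclusion strict, but both sets have three elements.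
  ⊇⇒⊆ : {s t : Triangle n} → vertices t ⊆ vertices s → vertices s ⊆ vertices t
  ⊇⇒⊆ {s = s} {t} t⊆s {z} z∈s = decidable-stable (z ∈? vertices t) λ z∉t →
    <-irrefl (trans (card t) (sym (card s))) (p⊂q⇒∣p∣<∣q∣ (t⊆s , z , z∈s , z∉t))

  -- Edges of a triangle, and shares of an edge by its multiplicity.

  isEdgeOf? : (x y : Fin n) (t : Triangle n) → Dec (IsEdgeOf x y t)
  isEdgeOf? x y t = ¬? (x ≟ y) ×-dec (x ∈? vertices t) ×-dec (y ∈? vertices t)

  isEdgeOf-sym : ∀ {x y} {t : Triangle n} → IsEdgeOf x y t → IsEdgeOf y x t
  isEdgeOf-sym (x≢y , x∈ , y∈) = ≢-sym x≢y , y∈ , x∈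

  -- The value at 0 is immaterial.
  weight : ℕ → ℕ
  weight 0 = 2
  weight 1 = 2
  weight 2 = 1
  weight _ = 0

  weight-≤1 : ∀ {m} → m ≤ 1 → weight m ≡ 2
  weight-≤1 z≤n       = refl
  weight-≤1 (s≤s z≤n) = refl

  weight-≤2 : ∀ {m} → m ≤ 2 → 1 ≤ weight m
  weight-≤2 z≤n             = s≤s z≤n
  weight-≤2 (s≤s z≤n)       = s≤s z≤n
  weight-≤2 (s≤s (s≤s z≤n)) = s≤s z≤n

  -- The `m` members on an edge together never receive more than two shares of it.
  m*weight≤2 : ∀ m → m * weight m ≤ 2
  m*weight≤2 0 = z≤n
  m*weight≤2 1 = ≤-refl
  m*weight≤2 2 = ≤-refl
  m*weight≤2 (suc (suc (suc m))) = subst (_≤ 2) (sym (*-zeroʳ m)) z≤n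

  -- With the larger number written as the smaller plus `c`, the two sides differ by `c * c`.
  4ab≤[a+b]² : ∀ a b → 4 * (a * b) ≤ (a + b) * (a + b)
  4ab≤[a+b]² a b with ≤-total a b
  ... | inj₁ a≤b with m≤n⇒∃[o]m+o≡n a≤b
  ...   | c , refl = subst (4 * (a * (a + c)) ≤_) (square a c) (m≤m+n _ (c * c))
    where
    square : ∀ a c → 4 * (a * (a + c)) + c * c ≡ (a + (a + c)) * (a + (a + c))
    square = solve-∀
  4ab≤[a+b]² a b | inj₂ b≤a with m≤n⇒∃[o]m+o≡n b≤a
  ...   | c , refl = subst (4 * ((b + c) * b) ≤_) (square b c) (m≤m+n _ (c * c))
    where
    square : ∀ b c → 4 * ((b + c) * b) + c * c ≡ (b + c + b) * (b + c + b)
    square = solve-∀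

  -- Covered pairs in a rainbow-free family.

  module RainbowFree {n : ℕ} (T : Family n) (rainbow-free : ¬ RainbowTriangle T) where

    private
      L = length T

      edge? : (i : Member T) (x y : Fin n) → Dec (IsEdgeOf x y (lookup T i))
      edge? i x y = isEdgeOf? x y (lookup T i)

      V : Member T → Subset n
      V i = vertices (lookup T i)

    -- The form in which rainbow-freeness enters every later argument.
    not-all-distinct : ∀ {x y z i j k} → IsEdgeOf x y (lookup T i) → IsEdgeOf y z (lookup T j) →
                       IsEdgeOf x z (lookup T k) → i ≡ j ⊎ j ≡ k ⊎ i ≡ k
    not-all-distinct {i = i} {j} {k} xy yz xz with i ≟ j | j ≟ k | i ≟ k
    ... | yes i≡j | _       | _       = inj₁ i≡j
    ... | no _    | yes j≡k | _       = inj₂ (inj₁ j≡k)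
    ... | no _    | no _    | yes i≡k = inj₂ (inj₂ i≡k)
    ... | no i≢j  | no j≢k  | no i≢k  = contradiction
      (record { x≢y = proj₁ xy ; y≢z = proj₁ yz ; x≢z = proj₁ xz ; t₁≢t₂ = i≢j ; t₂≢t₃ = j≢k
              ; t₁≢t₃ = i≢k ; xy∈t₁ = xy ; yz∈t₂ = yz ; xz∈t₃ = xz }) rainbow-free

    Covered : Fin n → Fin n → Set
    Covered x y = ∃[ i ] IsEdgeOf x y (lookup T i)

    covered? : ∀ x y → Dec (Covered x y)
    covered? x y = any? λ i → edge? i x y

    -- Two of the three edges come from the same member, and two edges already contain all three
    -- vertices.
    covered-triangle : ∀ {p q z i} → IsEdgeOf p q (lookup T i) → Covered p z → Covered q z →
                       ∃[ j ] (p ∈ V j × q ∈ V j × z ∈ V j)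
    covered-triangle {i = i} pq@(_ , p∈ , q∈) (j , pz@(_ , p∈′ , z∈)) (k , qz@(_ , q∈′ , z∈′))
      with not-all-distinct pq qz pz
    ... | inj₁ refl        = i , p∈ , q∈ , z∈′
    ... | inj₂ (inj₁ refl) = j , p∈′ , q∈′ , z∈
    ... | inj₂ (inj₂ refl) = j , p∈ , q∈ , z∈

    -- The vertex `x` is itself counted, since no pair `x x` is covered; this is n minus the degree.
    antidegree : Fin n → ℕ
    antidegree x = sum λ z → indicator (¬? (covered? x z))

    multiplicity : Fin n → Fin n → ℕ
    multiplicity x y = sum λ i → indicator (edge? i x y)

    multiplicity-sym : ∀ x y → multiplicity x y ≡ multiplicity y x
    multiplicity-sym x y = ≤-antisym (below x y) (below y x)
      where
      below : ∀ x y → multiplicity x y ≤ multiplicity y x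
      below x y = sum-mono-≤ λ i → indicator-mono (edge? i x y) (edge? i y x) (isEdgeOf-sym {t = lookup T i})

    -- Exclusive edges and the two kinds of members.

    record Exclusive (k : ℕ) (i : Member T) (p q : Fin n) : Set where
      field
        few     : multiplicity p q ≤ k
        only-in : ∀ {j} → p ∈ V j → q ∈ V j → V j ⊆ V i

    exclusive-sym : ∀ {k i p q} → Exclusive k i p q → Exclusive k i q p
    exclusive-sym {k} {i} {p} {q} e = record
      { few     = subst (_≤ k) (multiplicity-sym p q) (Exclusive.few e)
      ; only-in = λ q∈ p∈ → Exclusive.only-in e p∈ q∈ }

    Shared : Member T → Fin n → Fin n → Set
    Shared i x y = ∃[ j ] (j ≢ i × IsEdgeOf x y (lookup T j))

    private-exclusive : ∀ {i p q} → p ≢ q → ¬ Shared i p q → Exclusive 1 i p q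
    private-exclusive {i} {p} {q} p≢q alone = record
      { few     = subst (multiplicity p q ≤_) (sum-point i)
                   (sum-mono-≤ λ j → indicator-mono (edge? j p q) (j ≟ i) only)
      ; only-in = λ {j} p∈ q∈ → subst (λ j → V j ⊆ V i) (sym (only (p≢q , p∈ , q∈))) (λ z∈ → z∈) }
      where
      only : ∀ {j} → IsEdgeOf p q (lookup T j) → j ≡ i
      only {j} pq = decidable-stable (j ≟ i) λ j≢i → alone (j , j≢i , pq)

    twin-exclusive : ∀ {i s p q} → V s ⊆ V i → p ≢ q →
                     (∀ {j} → IsEdgeOf p q (lookup T j) → j ≡ i ⊎ j ≡ s) → Exclusive 2 i p q
    twin-exclusive {i} {s} {p} {q} s⊆i p≢q only = record
      { few     = begin
          multiplicity p q
            ≤⟨ sum-mono-≤ (λ j → indicator-⊎ (edge? j p q) (j ≟ i) (j ≟ s) only) ⟩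
          sum (λ j → indicator (j ≟ i) + indicator (j ≟ s))
            ≡⟨ ∑-distrib-+ (λ j → indicator (j ≟ i)) _ ⟩
          sum (λ j → indicator (j ≟ i)) + sum (λ j → indicator (j ≟ s))
            ≡⟨ cong₂ _+_ (sum-point i) (sum-point s) ⟩
          2 ∎
      ; only-in = λ p∈ q∈ → contained (only (p≢q , p∈ , q∈)) }
      where
      open ≤-Reasoning
      contained : ∀ {j} → j ≡ i ⊎ j ≡ s → V j ⊆ V i
      contained (inj₁ refl) z∈ = z∈
      contained (inj₂ refl) z∈ = s⊆i z∈

    data Kind (i : Member T) : Set where
      light : ∀ {p q r} → Corners (lookup T i) p q r →
              Exclusive 1 i p q → Exclusive 1 i q r → Kind i
      heavy : ∀ {p q r} → Corners (lookup T i) p q r →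
              Exclusive 2 i p q → Exclusive 2 i q r → Exclusive 2 i p r → Kind i

    shared? : ∀ i x y → Dec (Shared i x y)
    shared? i x y = any? λ j → ¬? (j ≟ i) ×-dec edge? j x y

    shared-sym : ∀ {i x y} → Shared i x y → Shared i y x
    shared-sym (j , j≢i , xy) = j , j≢i , isEdgeOf-sym {t = lookup T j} xy

    -- Since `i` supplies the edge `p r`, the members sharing the other two edges must be one member
    -- `s`. It contains all three corners, so it equals `i` as a set. A further member on any edge
    -- would form a rainbow triangle with `i` and `s`.
    two-shared⇒heavy : ∀ {i p q r} → Corners (lookup T i) p q r → Shared i p q → Shared i q r → Kind i
    two-shared⇒heavy {i} {p} {q} {r} c (s , s≢i , pq) (s′ , s′≢i , qr)
      with not-all-distinct {k = i} pq qr (p≢r c , p∈ c , r∈ c)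
    ... | inj₂ (inj₁ s′≡i) = contradiction s′≡i s′≢i
    ... | inj₂ (inj₂ s≡i)  = contradiction s≡i s≢i
    ... | inj₁ refl = heavy c (twin-exclusive s⊆i (p≢q c) pq-only) (twin-exclusive s⊆i (q≢r c) qr-only)
                              (twin-exclusive s⊆i (p≢r c) pr-only)
      where
      i⊆s : V i ⊆ V s
      i⊆s z∈ with cover c z∈
      ... | inj₁ refl        = proj₁ (proj₂ pq)
      ... | inj₂ (inj₁ refl) = proj₁ (proj₂ qr)
      ... | inj₂ (inj₂ refl) = proj₂ (proj₂ qr)
      s⊆i : V s ⊆ V i
      s⊆i = ⊇⇒⊆ {s = lookup T s} {t = lookup T i} i⊆s
      pq-only : ∀ {j} → IsEdgeOf p q (lookup T j) → j ≡ i ⊎ j ≡ s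
      pq-only e with not-all-distinct {k = i} e qr (p≢r c , p∈ c , r∈ c)
      ... | inj₁ j≡s        = inj₂ j≡s
      ... | inj₂ (inj₁ s≡i) = contradiction s≡i s≢i
      ... | inj₂ (inj₂ j≡i) = inj₁ j≡i
      qr-only : ∀ {j} → IsEdgeOf q r (lookup T j) → j ≡ i ⊎ j ≡ s
      qr-only e with not-all-distinct {k = i} pq e (p≢r c , p∈ c , r∈ c)
      ... | inj₁ s≡j        = inj₂ (sym s≡j)
      ... | inj₂ (inj₁ j≡i) = inj₁ j≡i
      ... | inj₂ (inj₂ s≡i) = contradiction s≡i s≢i
      pr-only : ∀ {j} → IsEdgeOf p r (lookup T j) → j ≡ i ⊎ j ≡ s
      pr-only e with not-all-distinct {j = i} pq (q≢r c , q∈ c , r∈ c) e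
      ... | inj₁ s≡i        = contradiction s≡i s≢i
      ... | inj₂ (inj₁ i≡j) = inj₁ (sym i≡j)
      ... | inj₂ (inj₂ s≡j) = inj₂ (sym s≡j)

    -- Either two edges are shared or two are unshared; the corners are reordered so that these two
    -- meet in the middle one.
    kind : ∀ i → Kind i
    kind i with corners (lookup T i)
    ... | p , q , r , c with shared? i p q | shared? i q r | shared? i p r
    ... | yes pq | yes qr | _      = two-shared⇒heavy c pq qr
    ... | yes pq | no _   | yes pr = two-shared⇒heavy (swap₁₂ c) (shared-sym pq) pr
    ... | no _   | yes qr | yes pr = two-shared⇒heavy (swap₂₃ c) pr (shared-sym qr)
    ... | no pq  | no qr  | _      =
      light c (private-exclusive (p≢q c) pq) (private-exclusive (q≢r c) qr)
    ... | no pq  | yes _  | no pr  =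
      light (swap₁₂ c) (exclusive-sym (private-exclusive (p≢q c) pq)) (private-exclusive (p≢r c) pr)
    ... | yes _  | no qr  | no pr  =
      light (swap₂₃ c) (private-exclusive (p≢r c) pr) (exclusive-sym (private-exclusive (q≢r c) qr))

    -- Lower bounds on antidegrees.

    -- The vertices `p`, `q`, `z` span a member, which exclusivity places inside `i`; so `z` is a
    -- corner of `i` other than `p` and `q`.
    apex : ∀ {k i p q r z} → Corners (lookup T i) p q r → Exclusive k i p q →
           Covered p z → Covered q z → z ≡ r
    apex {i = i} c e pz@(_ , p≢z , _) qz@(_ , q≢z , _)
      with covered-triangle {i = i} (p≢q c , p∈ c , q∈ c) pz qz
    ... | j , p∈j , q∈j , z∈j with cover c (Exclusive.only-in e p∈j q∈j z∈j)
    ...   | inj₁ z≡p        = contradiction (sym z≡p) p≢z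
    ...   | inj₂ (inj₁ z≡q) = contradiction (sym z≡q) q≢z
    ...   | inj₂ (inj₂ z≡r) = z≡r

    uncovered-diagonal : ∀ {x z} → z ≡ x → ¬ Covered x z
    uncovered-diagonal z≡x (_ , x≢z , _) = x≢z (sym z≡x)

    -- By `apex`, every vertex except possibly `r` is unjoined to `p` or to `q`; the 1 pays for `r`.
    antidegrees-light : ∀ {k i p q r} → Corners (lookup T i) p q r → Exclusive k i p q →
                        n ≤ antidegree p + antidegree q + 1
    antidegrees-light {i = i} {p} {q} {r} c e = begin
      n                                             ≡⟨ *-identityʳ n ⟨
      n * 1                                         ≡⟨ sum-const n 1 ⟨
      sum {n} (λ _ → 1)                             ≤⟨ sum-mono-≤ (λ z →
        one≤ (covered? p z) (covered? q z) (z ≟ r) (apex c e)) ⟩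
      sum (λ z → u p z + u q z + indicator (z ≟ r)) ≡⟨ ∑-distrib-+ (λ z → u p z + u q z) _ ⟩
      sum (λ z → u p z + u q z) + sum (λ z → indicator (z ≟ r))
        ≡⟨ cong₂ _+_ (∑-distrib-+ (u p) (u q)) (sum-point r) ⟩
      antidegree p + antidegree q + 1               ∎
      where
      open ≤-Reasoning
      u : Fin n → Fin n → ℕ
      u x z = indicator (¬? (covered? x z))

    -- By `apex` on all three edges, a vertex outside the triangle is joined to at most one corner.
    -- A corner is surely unjoined only to itself, so each corner needs one extra unit, hence the 3.
    antidegrees-heavy : ∀ {k i p q r} → Corners (lookup T i) p q r →
                        Exclusive k i p q → Exclusive k i q r → Exclusive k i p r →
                        n * 2 ≤ antidegree p + antidegree q + antidegree r + 3
    antidegrees-heavy {i = i} {p} {q} {r} c pq qr pr = begin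
      n * 2                                          ≡⟨ sum-const n 2 ⟨
      sum {n} (λ _ → 2)                              ≤⟨ sum-mono-≤ (λ z →
        two≤ (covered? p z) (covered? q z) (covered? r z) (z ≟ p) (z ≟ q) (z ≟ r)
          uncovered-diagonal uncovered-diagonal uncovered-diagonal
          (apex (swap₂₃ (swap₁₂ c)) qr) (apex (swap₂₃ c) pr) (apex c pq)) ⟩
      sum (λ z → U z + D z)                          ≡⟨ ∑-distrib-+ U D ⟩
      sum U + sum D                                  ≡⟨ cong₂ _+_ (sum₃ (u p) (u q) (u r)) (sum₃ (δ p) (δ q) (δ r)) ⟩
      antidegree p + antidegree q + antidegree r + (sum (δ p) + sum (δ q) + sum (δ r))
        ≡⟨ cong (antidegree p + antidegree q + antidegree r +_)
             (cong₂ _+_ (cong₂ _+_ (sum-point p) (sum-point q)) (sum-point r)) ⟩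
      antidegree p + antidegree q + antidegree r + 3 ∎
      where
      open ≤-Reasoning
      u δ : Fin n → Fin n → ℕ
      u x z = indicator (¬? (covered? x z))
      δ x z = indicator (z ≟ x)
      U D : Fin n → ℕ
      U z = u p z + u q z + u r z
      D z = δ p z + δ q z + δ r z
      sum₃ : (f g h : Vector ℕ n) → sum (λ z → f z + g z + h z) ≡ sum f + sum g + sum h
      sum₃ f g h = trans (∑-distrib-+ (λ z → f z + g z) h) (cong (_+ sum h) (∑-distrib-+ f g))

    -- Charging antidegrees to members.

    -- The part paid by the end `x` alone. Summing over ordered pairs lets each edge pay for both of
    -- its ends.
    charge : Member T → Fin n → Fin n → ℕ
    charge i x y = indicator (edge? i x y) * weight (multiplicity x y) * antidegree x

    total-charge : Member T → ℕ
    total-charge i = sum λ x → sum λ y → charge i x y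

    charge-private : ∀ {i p q} → IsEdgeOf p q (lookup T i) → Exclusive 1 i p q → charge i p q ≡ 2 * antidegree p
    charge-private {i} {p} {q} pq e = cong₂ (λ a b → a * b * antidegree p)
      (indicator-true (edge? i p q) pq) (weight-≤1 (Exclusive.few e))

    charge-twin : ∀ {i p q} → IsEdgeOf p q (lookup T i) → Exclusive 2 i p q → antidegree p ≤ charge i p q
    charge-twin {i} {p} {q} pq e = begin
      antidegree p                                 ≡⟨ *-identityˡ _ ⟨
      1 * antidegree p                             ≤⟨ *-monoˡ-≤ (antidegree p) (weight-≤2 (Exclusive.few e)) ⟩
      weight (multiplicity p q) * antidegree p     ≡⟨ cong (_* antidegree p) (*-identityˡ (weight (multiplicity p q))) ⟨
      1 * weight (multiplicity p q) * antidegree p ≡⟨ cong (λ a → a * weight (multiplicity p q) * antidegree p)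
          (indicator-true (edge? i p q) pq) ⟨
      charge i p q                                 ∎
      where open ≤-Reasoning

    -- A light member gets two full edges, each worth at least 2(n - 1), so 4n - 4. A heavy one gets
    -- at least half of each of its three edges, which is twice the sum of its antidegrees, so 4n -
    -- 6.
    total-charge-lower : ∀ i → 4 * n ≤ total-charge i + 6
    total-charge-lower i with kind i
    ... | light {p} {q} {r} c pq qr = begin
      4 * n
        ≡⟨ double n ⟩
      2 * (n + n)
        ≤⟨ *-monoʳ-≤ 2 (+-mono-≤ (antidegrees-light c pq) (antidegrees-light (swap₂₃ (swap₁₂ c)) qr)) ⟩
      2 * (P + Q + 1 + (Q + R + 1))
        ≡⟨ collect P Q R ⟩
      2 * P + (2 * Q + 2 * Q + 2 * R) + 4
        -- The light case loses only 4; it is weakened to the 6 of the heavy case.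
        ≤⟨ +-mono-≤ rows (m≤m+n 4 2) ⟩
      total-charge i + 6 ∎
      where
      open ≤-Reasoning
      P = antidegree p
      Q = antidegree q
      R = antidegree r
      double : ∀ n → 4 * n ≡ 2 * (n + n)
      double = solve-∀
      collect : ∀ P Q R → 2 * (P + Q + 1 + (Q + R + 1)) ≡
                          2 * P + (2 * Q + 2 * Q + 2 * R) + 4
      collect = solve-∀
      rows : 2 * P + (2 * Q + 2 * Q + 2 * R) ≤ total-charge i
      rows = begin
        2 * P + (2 * Q + 2 * Q + 2 * R)
          ≡⟨ cong₂ _+_ (charge-private (p≢q c , p∈ c , q∈ c) pq)
               (cong₂ _+_ (cong₂ _+_ (charge-private (≢-sym (p≢q c) , q∈ c , p∈ c) (exclusive-sym pq))
                                         (charge-private (q≢r c , q∈ c , r∈ c) qr))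
                            (charge-private (≢-sym (q≢r c) , r∈ c , q∈ c) (exclusive-sym qr))) ⟨
        -- The edges `p q` and `q r` in both directions; row `q` holds two of the four terms.
        charge i p q + (charge i q p + charge i q r + charge i r q)
          ≤⟨ +-mono-≤ (term≤sum (charge i p) q)
               (+-mono-≤ (two-terms≤sum (charge i q) (p≢r c)) (term≤sum (charge i r) q)) ⟩
        sum (charge i p) + (sum (charge i q) + sum (charge i r))
          ≤⟨ three-terms≤sum (λ x → sum (charge i x)) (p≢q c) (q≢r c) (p≢r c) ⟩
        total-charge i ∎
    ... | heavy {p} {q} {r} c pq qr pr = begin
      4 * n
        ≡⟨ double n ⟩
      2 * (n * 2)
        ≤⟨ *-monoʳ-≤ 2 (antidegrees-heavy c pq qr pr) ⟩
      2 * (P + Q + R + 3)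
        ≡⟨ collect P Q R ⟩
      P + P + (Q + Q + (R + R)) + 6
        ≤⟨ +-monoˡ-≤ 6 rows ⟩
      total-charge i + 6 ∎
      where
      open ≤-Reasoning
      P = antidegree p
      Q = antidegree q
      R = antidegree r
      double : ∀ n → 4 * n ≡ 2 * (n * 2)
      double = solve-∀
      collect : ∀ P Q R → 2 * (P + Q + R + 3) ≡ P + P + (Q + Q + (R + R)) + 6
      collect = solve-∀
      row : ∀ {x y z} → Corners (lookup T i) x y z → Exclusive 2 i x y → Exclusive 2 i x z →
            antidegree x + antidegree x ≤ sum (charge i x)
      row {x} c xy xz = ≤-trans
        (+-mono-≤ (charge-twin (p≢q c , p∈ c , q∈ c) xy) (charge-twin (p≢r c , p∈ c , r∈ c) xz))
        (two-terms≤sum (charge i x) (q≢r c))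
      rows : P + P + (Q + Q + (R + R)) ≤ total-charge i
      rows = ≤-trans
        (+-mono-≤ (row c pq pr) (+-mono-≤ (row (swap₁₂ c) (exclusive-sym pq) qr)
          (row (swap₁₂ (swap₂₃ c)) (exclusive-sym pr) (exclusive-sym qr))))
        (three-terms≤sum (λ x → sum (charge i x)) (p≢q c) (q≢r c) (p≢r c))

    -- Upper bound on the total charge.

    degree : Fin n → ℕ
    degree x = sum λ y → indicator (covered? x y)

    degree+antidegree : ∀ x → degree x + antidegree x ≡ n
    degree+antidegree x = trans (sym (∑-distrib-+ (λ y → indicator (covered? x y)) _))
      (trans (sum-cong-≗ λ y → indicator-complement (covered? x y))
        (trans (sum-const n 1) (*-identityʳ n)))

    pair-charge-upper : ∀ x y → sum (λ i → charge i x y) ≤ indicator (covered? x y) * (2 * antidegree x)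
    pair-charge-upper x y = begin
      sum (λ i → charge i x y)
        ≡⟨ *-distribʳ-sum (antidegree x) (λ i → indicator (edge? i x y) * w) ⟨
      sum (λ i → indicator (edge? i x y) * w) * antidegree x
        ≡⟨ cong (_* antidegree x) (*-distribʳ-sum w (λ i → indicator (edge? i x y))) ⟨
      multiplicity x y * w * antidegree x
        ≤⟨ *-monoˡ-≤ (antidegree x) bound ⟩
      indicator (covered? x y) * 2 * antidegree x
        ≡⟨ *-assoc (indicator (covered? x y)) 2 _ ⟩
      indicator (covered? x y) * (2 * antidegree x) ∎
      where
      open ≤-Reasoning
      w = weight (multiplicity x y)
      bound : multiplicity x y * w ≤ indicator (covered? x y) * 2
      bound with covered? x y
      ... | yes _ = m*weight≤2 (multiplicity x y)
      -- An uncovered pair has multiplicity 0, so whatever weight 0 receives is multiplied away.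
      ... | no ¬xy = ≤-reflexive (cong (_* w) (n≤0⇒n≡0 (begin
        multiplicity x y  ≤⟨ sum-mono-≤ (λ i → indicator-mono (edge? i x y) (no ¬xy) (i ,_)) ⟩
        sum {L} (λ _ → 0) ≡⟨ sum-replicate-zero L ⟩
        0                 ∎)))

    -- After exchanging the sums, each vertex pays at most twice its degree times its antidegree.
    -- These two add up to `n`, so the doubled payment is at most n² by `4ab≤[a+b]²`.
    sum-total-charge : 2 * sum total-charge ≤ n * (n * n)
    sum-total-charge = begin
      2 * sum total-charge
        ≡⟨ cong (2 *_) (∑-comm λ i x → sum (charge i x)) ⟩
      2 * sum (λ x → sum λ i → sum λ y → charge i x y)
        ≡⟨ *-distribˡ-sum 2 (λ x → sum λ i → sum λ y → charge i x y) ⟩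
      sum (λ x → 2 * sum λ i → sum λ y → charge i x y)
        ≤⟨ sum-mono-≤ row ⟩
      sum {n} (λ _ → n * n)
        ≡⟨ sum-const n (n * n) ⟩
      n * (n * n) ∎
      where
      open ≤-Reasoning
      regroup : ∀ d c → 2 * (d * (2 * c)) ≡ 4 * (d * c)
      regroup = solve-∀
      row : ∀ x → 2 * sum (λ i → sum λ y → charge i x y) ≤ n * n
      row x = begin
        2 * sum (λ i → sum λ y → charge i x y)
          ≡⟨ cong (2 *_) (∑-comm λ i y → charge i x y) ⟩
        2 * sum (λ y → sum λ i → charge i x y)
          ≤⟨ *-monoʳ-≤ 2 (sum-mono-≤ (pair-charge-upper x)) ⟩
        2 * sum (λ y → indicator (covered? x y) * (2 * antidegree x))
          ≡⟨ cong (2 *_) (*-distribʳ-sum (2 * antidegree x) (λ y → indicator (covered? x y))) ⟨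
        2 * (degree x * (2 * antidegree x))
          ≡⟨ regroup (degree x) (antidegree x) ⟩
        4 * (degree x * antidegree x)
          ≤⟨ 4ab≤[a+b]² (degree x) (antidegree x) ⟩
        (degree x + antidegree x) * (degree x + antidegree x)
          ≡⟨ cong₂ _*_ (degree+antidegree x) (degree+antidegree x) ⟩
        n * n ∎

    -- Double counting of the total charge; the loss of 6 per member stays on the right to avoid
    -- subtraction.
    size-bound : L * (8 * n) ≤ n * (n * n) + 12 * L
    size-bound = begin
      L * (8 * n)
        ≡⟨ double L n ⟩
      2 * (L * (4 * n))
        ≡⟨ cong (2 *_) (sum-const L (4 * n)) ⟨
      2 * sum {L} (λ _ → 4 * n)
        ≤⟨ *-monoʳ-≤ 2 (sum-mono-≤ total-charge-lower) ⟩
      2 * sum (λ i → total-charge i + 6)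
        ≡⟨ cong (2 *_) (trans (∑-distrib-+ total-charge (λ _ → 6)) (cong (sum total-charge +_) (sum-const L 6))) ⟩
      2 * (sum total-charge + L * 6)
        ≡⟨ expand (sum total-charge) L ⟩
      2 * sum total-charge + 12 * L
        ≤⟨ +-monoˡ-≤ (12 * L) sum-total-charge ⟩
      n * (n * n) + 12 * L ∎
      where
      open ≤-Reasoning
      double : ∀ L n → L * (8 * n) ≡ 2 * (L * (4 * n))
      double = solve-∀
      expand : ∀ s L → 2 * (s + L * 6) ≡ 2 * s + 12 * L
      expand = solve-∀

  -- From the cubic bound to the factor 1 + ε.

  -- Here ε is `suc a` over `suc b`, with denominators cleared. For large `n` the error term is at
  -- most `L * n`, which a crude bound on `L` places below n³.
  size-bound-integral : ∀ a b L n → n ≥ 12 * suc b →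
    L * (8 * n) ≤ n * (n * n) + 12 * L →
    L * (8 * suc b) ≤ (suc b + suc a) * (n * n)
  size-bound-integral a b L n@(suc _) n≥12b bound = *-cancelʳ-≤ _ _ n (begin
    L * (8 * D) * n                           ≡⟨ e₁ L D n ⟩
    D * (L * (8 * n))                         ≤⟨ *-monoʳ-≤ D bound ⟩
    D * (n * (n * n) + 12 * L)                ≡⟨ e₂ L D n ⟩
    D * (n * (n * n)) + L * (12 * D)          ≤⟨ +-monoʳ-≤ (D * (n * (n * n))) (*-monoʳ-≤ L n≥12b) ⟩
    D * (n * (n * n)) + L * n                 ≤⟨ +-monoʳ-≤ (D * (n * (n * n))) crude ⟩
    -- The numerator of ε is at least 1, so one copy of n³ fits into `suc a` copies.
    D * (n * (n * n)) + n * (n * n)           ≤⟨ +-monoʳ-≤ (D * (n * (n * n))) (m≤m+n _ (a * (n * (n * n)))) ⟩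
    D * (n * (n * n)) + suc a * (n * (n * n)) ≡⟨ e₃ (suc a) D n ⟩
    (D + suc a) * (n * n) * n                 ∎)
    where
    open ≤-Reasoning
    D = suc b
    e₁ : ∀ L D n → L * (8 * D) * n ≡ D * (L * (8 * n))
    e₁ = solve-∀
    e₂ : ∀ L D n → D * (n * (n * n) + 12 * L) ≡ D * (n * (n * n)) + L * (12 * D)
    e₂ = solve-∀
    e₃ : ∀ A D n → D * (n * (n * n)) + A * (n * (n * n)) ≡ (D + A) * (n * n) * n
    e₃ = solve-∀
    e₄ : ∀ L n → 7 * (L * n) + L * n ≡ L * (8 * n)
    e₄ = solve-∀
    12≤n : 12 ≤ n
    12≤n = ≤-trans (m≤m*n 12 D) n≥12b
    crude : L * n ≤ n * (n * n)
    -- From `12 ≤ n` even 7 L n ≤ n³ follows; the factor 7 is given away.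
    crude = ≤-trans (m≤m+n (L * n) (6 * (L * n))) (+-cancelʳ-≤ (L * n) _ _ (begin
      7 * (L * n) + L * n  ≡⟨ e₄ L n ⟩
      L * (8 * n)          ≤⟨ bound ⟩
      n * (n * n) + 12 * L ≡⟨ cong (n * (n * n) +_) (*-comm 12 L) ⟩
      n * (n * n) + L * 12 ≤⟨ +-monoʳ-≤ (n * (n * n)) (*-monoʳ-≤ L 12≤n) ⟩
      n * (n * n) + L * n  ∎))

  open import Data.Integer as ℤ using (+_)
  import Data.Integer.Properties as ℤ
  open import Data.Rational.Unnormalised as ℚᵘ using (mkℚᵘ; *≤*)

  -- Cross-multiplication: unnormalised arithmetic cancels no common factors, so the denominator on
  -- the right is literally `1 * suc b * 8`.
  rational-bound : ∀ a b n L → L * (8 * suc b) ≤ (suc b + suc a) * (n * n) →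
    mkℚᵘ (+ L) 0 ℚᵘ.≤ (ℚᵘ.1ℚᵘ ℚᵘ.+ mkℚᵘ (+ suc a) b) ℚᵘ.* mkℚᵘ (+ (n ^ 2)) 7
  rational-bound a b n L le = *≤* (begin
    (+ L) ℤ.* (+ (1 * suc b * 8))                   ≡⟨ ℤ.pos-* L _ ⟨
    + (L * (1 * suc b * 8))                         ≡⟨ cong +_ (e₁ L (suc b)) ⟩
    + (L * (8 * suc b))                             ≤⟨ ℤ.+≤+ le ⟩
    + ((suc b + suc a) * (n * n))                   ≡⟨ cong +_ (e₂ (suc b) (suc a) n) ⟩
    + ((1 * suc b + suc a * 1) * (n ^ 2))           ≡⟨ ℤ.pos-* (1 * suc b + suc a * 1) (n ^ 2) ⟩
    + (1 * suc b + suc a * 1) ℤ.* + (n ^ 2)         ≡⟨ ℤ.*-identityʳ _ ⟨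
    + (1 * suc b + suc a * 1) ℤ.* + (n ^ 2) ℤ.* + 1 ∎)
    where
    open ℤ.≤-Reasoning
    e₁ : ∀ L d → L * (1 * d * 8) ≡ L * (8 * d)
    e₁ = solve-∀
    e₂ : ∀ d c n → (d + c) * (n * n) ≡ (1 * d + c * 1) * (n * (n * 1))
    e₂ = solve-∀

open Combinatorics using (module RainbowFree; size-bound-integral; rational-bound)

open import Data.Integer as ℤ using (+_)
open import Data.Rational.Unnormalised as ℚᵘ using (mkℚᵘ)
open import Data.Rational using (ℚ; mkℚ; 0ℚ; 1ℚ; _/_; _+_; _*_; _≤_; _>_; toℚᵘ; *<*)
import Data.Rational.Unnormalised.Properties as ℚᵘ
open import Data.Rational.Properties using (toℚᵘ-cancel-≤; toℚᵘ-fromℚᵘ; toℚᵘ-homo-+; toℚᵘ-homo-*)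

theorem3p1 : ∀ (ε : ℚ) → ε > 0ℚ →
    ∃[ N ] (∀ (n : ℕ) → n ≥ N → (T : Family n) → ¬ RainbowTriangle T →
    (+ length T) / 1 ≤ (1ℚ + ε) * ((+ (n ^ 2)) / 8))
theorem3p1 (mkℚ (+ zero) _ _) (*<* (ℤ.+<+ ()))
-- The threshold is 12 times the denominator of ε, as `size-bound-integral` requires.
theorem3p1 ε@(mkℚ (+ suc a) b _) _ = 12 ℕ.* suc b , λ n n≥N T rf → toℚᵘ-cancel-≤ (begin
  toℚᵘ ((+ length T) / 1)                      ≃⟨ toℚᵘ-fromℚᵘ (mkℚᵘ (+ length T) 0) ⟩
  mkℚᵘ (+ length T) 0                          ≤⟨ rational-bound a b n (length T)
    (size-bound-integral a b (length T) n n≥N (RainbowFree.size-bound T rf)) ⟩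
  (ℚᵘ.1ℚᵘ ℚᵘ.+ toℚᵘ ε) ℚᵘ.* mkℚᵘ (+ (n ^ 2)) 7 ≃⟨ ℚᵘ.*-cong (toℚᵘ-homo-+ 1ℚ ε) (toℚᵘ-fromℚᵘ (mkℚᵘ (+ (n ^ 2)) 7)) ⟨
  toℚᵘ (1ℚ + ε) ℚᵘ.* toℚᵘ ((+ (n ^ 2)) / 8)    ≃⟨ toℚᵘ-homo-* (1ℚ + ε) _ ⟨
  toℚᵘ ((1ℚ + ε) * ((+ (n ^ 2)) / 8))          ∎)
  where open ℚᵘ.≤-Reasoning
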